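{- Let $V$ be a finite set of propositional variables, $\mathcal{F}=(V,\Gamma,O_1,\dots,O_n)$ a knowledge structure, $\alpha$ a propositional formula over $V$, and, for an agent $i\in\{1,\dots,n\}$, let $WSC_i^\alpha$ and $SNC_i^\alpha$ be a weakest sufficient condition and a strongest necessary condition, respectively, of $\alpha$ over $O_i$ under $\Gamma$. Then, for each state $s$ of $\mathcal{F}$, $$(\mathcal{F},s)\models K_i\alpha\Leftrightarrow WSC_i^\alpha \quad\text{and}\quad (\mathcal{F},s)\models \neg K_i\neg\alpha\Leftrightarrow SNC_i^\alpha .$$
   Context: A formula over a set $P$ of propositional variables is a propositional formula all of whose variables lie in $P$ (the constants $\mathbf{true},\mathbf{false}$ count as formulas over every $P$). A truth assignment over $P$ is identified with a subset of $P$ (the variables made true). For a set $\Gamma$ of propositional formulas, $\Gamma\models\varphi$ means that every assignment satisfying all of $\Gamma$ satisfies $\varphi$. A knowledge structure with $n$ agents is a tuple $\mathcal{F}=(V,\Gamma,O_1,\dots,O_n)$ where $V$ is a set of propositional variables, $\Gamma$ is a consistent set of propositional formulas over $V$, and $O_i\subseteq V$ for each agent $i$ ($O_i$ is the set of agent $i$'s observable variables). A state of $\mathcal{F}$ is an assignment $s\subseteq V$ satisfying $\Gamma$. Satisfaction $(\mathcal{F},s)\models\varphi$ at a state $s$: for a variable $p$, $(\mathcal{F},s)\models p$ iff $p\in s$; Boolean connectives as usual; $(\mathcal{F},s)\models K_i\alpha$ iff $(\mathcal{F},s')\models\alpha$ for all states $s'$ of $\mathcal{F}$ with $s'\cap O_i=s\cap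 O_i$. Given $V'\subseteq V$, a set $\Gamma$ of formulas over $V$ and a formula $\alpha$ over $V$: a formula $\varphi$ over $V'$ is a sufficient condition of $\alpha$ over $V'$ under $\Gamma$ if $\Gamma\models\varphi\Rightarrow\alpha$; it is a weakest sufficient condition if moreover $\Gamma\models\varphi'\Rightarrow\varphi$ for every sufficient condition $\varphi'$ of $\alpha$ over $V'$ under $\Gamma$. A formula $\varphi$ over $V'$ is a necessary condition of $\alpha$ over $V'$ under $\Gamma$ if $\Gamma\models\alpha\Rightarrow\varphi$; it is a strongest necessary condition if moreover $\Gamma\models\varphi\Rightarrow\varphi'$ for every necessary condition $\varphi'$ of $\alpha$ over $V'$ under $\Gamma$. -}

module Defs where

open import Data.Nat using (ℕ)
open import Data.Fin using (Fin)
open import Data.Fin.Subset using (Subset; _∈_; _⊆_; _∩_; _∪_; ⁅_⁆)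
  renaming (⊥ to ∅)
open import Data.Empty using (⊥)
open import Data.Unit using (⊤)
open import Data.Product using (∃; _×_; proj₁)
open import Data.Sum using (_⊎_)
open import Level using (0ℓ)
open import Relation.Nullary using (¬_)
open import Relation.Unary using (Pred)
open import Relation.Binary.PropositionalEquality using (_≡_)

infix  25 ¬'_
infixr 24 _∧'_
infixr 23 _∨'_
infixr 22 _⇒'_
infix  21 _⇔'_

-- The finite set V of propositional variables is Fin m, so that sets of
-- variables, and hence assignments, are elements of Subset m.

data Formula (m : ℕ) : Set where
  var    : Fin m → Formula m
  true'  : Formula m
  false' : Formula m
  ¬'_    : Formula m → Formula m
  _∧'_   : Formula m → Formula m → Formula m
  _∨'_   : Formula m → Formula m → Formula m
  _⇒'_   : Formula m → Formula m → Formula m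
  _⇔'_   : Formula m → Formula m → Formula m

vars : ∀ {m} → Formula m → Subset m
vars (var p)  = ⁅ p ⁆
vars true'    = ∅
vars false'   = ∅
vars (¬' φ)   = vars φ
vars (φ ∧' ψ) = vars φ ∪ vars ψ
vars (φ ∨' ψ) = vars φ ∪ vars ψ
vars (φ ⇒' ψ) = vars φ ∪ vars ψ
vars (φ ⇔' ψ) = vars φ ∪ vars ψ

_IsOver_ : ∀ {m} → Formula m → Subset m → Set
φ IsOver P = vars φ ⊆ P

Assignment : ℕ → Set
Assignment m = Subset m

-- Satisfaction of a propositional formula is decidable, by recursion on
-- the formula, so the type-theoretic reading of the connectives agrees with
-- their truth tables.

infix 4 _satisfies_ _satisfiesAll_ _⊨_

_satisfies_ : ∀ {m} → Assignment m → Formula m → Set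
s satisfies var p    = p ∈ s
s satisfies true'    = ⊤
s satisfies false'   = ⊥
s satisfies (¬' φ)   = ¬ (s satisfies φ)
s satisfies (φ ∧' ψ) = s satisfies φ × s satisfies ψ
s satisfies (φ ∨' ψ) = s satisfies φ ⊎ s satisfies ψ
s satisfies (φ ⇒' ψ) = s satisfies φ → s satisfies ψ
s satisfies (φ ⇔' ψ) = (s satisfies φ → s satisfies ψ)
                     × (s satisfies ψ → s satisfies φ)

-- Sets of formulas are arbitrary predicates, neither finite nor decidable.

FormulaSet : ℕ → Set₁
FormulaSet m = Pred (Formula m) 0ℓ

_satisfiesAll_ : ∀ {m} → Assignment m → FormulaSet m → Set
s satisfiesAll Γ = ∀ φ → Γ φ → s satisfies φ

_⊨_ : ∀ {m} → FormulaSet m → Formula m → Set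
Γ ⊨ φ = ∀ s → s satisfiesAll Γ → s satisfies φ

Consistent : ∀ {m} → FormulaSet m → Set
Consistent Γ = ∃ λ s → s satisfiesAll Γ

record KnowledgeStructure (m n : ℕ) : Set₁ where
  field
    Γ          : FormulaSet m
    consistent : Consistent Γ
    O          : Fin n → Subset m

open KnowledgeStructure public

State : ∀ {m n} → KnowledgeStructure m n → Set
State F = ∃ λ s → s satisfiesAll Γ F

data EpistemicFormula (m n : ℕ) : Set where
  var    : Fin m → EpistemicFormula m n
  true'  : EpistemicFormula m n
  false' : EpistemicFormula m n
  ¬'_    : EpistemicFormula m n → EpistemicFormula m n
  _∧'_   : EpistemicFormula m n → EpistemicFormula m n → EpistemicFormula m n
  _∨'_   : EpistemicFormula m n → EpistemicFormula m n → EpistemicFormula m n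
  _⇒'_   : EpistemicFormula m n → EpistemicFormula m n → EpistemicFormula m n
  _⇔'_   : EpistemicFormula m n → EpistemicFormula m n → EpistemicFormula m n
  K      : Fin n → EpistemicFormula m n → EpistemicFormula m n

⌜_⌝ : ∀ {m n} → Formula m → EpistemicFormula m n
⌜ var p ⌝  = var p
⌜ true' ⌝  = true'
⌜ false' ⌝ = false'
⌜ ¬' φ ⌝   = ¬' ⌜ φ ⌝
⌜ φ ∧' ψ ⌝ = ⌜ φ ⌝ ∧' ⌜ ψ ⌝
⌜ φ ∨' ψ ⌝ = ⌜ φ ⌝ ∨' ⌜ ψ ⌝
⌜ φ ⇒' ψ ⌝ = ⌜ φ ⌝ ⇒' ⌜ ψ ⌝
⌜ φ ⇔' ψ ⌝ = ⌜ φ ⌝ ⇔' ⌜ ψ ⌝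

-- Γ need not be decidable, so K i φ need not be either: here ¬', ∨', ⇒' and ⇔'
-- have their constructive meaning when applied to formulas containing K.

infix 4 [_,_]⊨_

[_,_]⊨_ : ∀ {m n} (F : KnowledgeStructure m n) →
          State F → EpistemicFormula m n → Set
[ F , s ]⊨ var p    = p ∈ proj₁ s
[ F , s ]⊨ true'    = ⊤
[ F , s ]⊨ false'   = ⊥
[ F , s ]⊨ (¬' φ)   = ¬ ([ F , s ]⊨ φ)
[ F , s ]⊨ (φ ∧' ψ) = ([ F , s ]⊨ φ) × ([ F , s ]⊨ ψ)
[ F , s ]⊨ (φ ∨' ψ) = ([ F , s ]⊨ φ) ⊎ ([ F , s ]⊨ ψ)
[ F , s ]⊨ (φ ⇒' ψ) = [ F , s ]⊨ φ → [ F , s ]⊨ ψ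
[ F , s ]⊨ (φ ⇔' ψ) = ([ F , s ]⊨ φ → [ F , s ]⊨ ψ)
                    × ([ F , s ]⊨ ψ → [ F , s ]⊨ φ)
[ F , s ]⊨ K i φ    = (s' : State F) →
                      proj₁ s' ∩ O F i ≡ proj₁ s ∩ O F i → [ F , s' ]⊨ φ

module _ {m : ℕ} (Γ : FormulaSet m) (α : Formula m) (V' : Subset m) where

  record IsSufficientCondition (φ : Formula m) : Set where
    field
      over       : φ IsOver V'
      sufficient : Γ ⊨ φ ⇒' α

  record IsWeakestSufficientCondition (φ : Formula m) : Set where
    field
      isSufficient : IsSufficientCondition φ
      weakest      : ∀ φ' → IsSufficientCondition φ' → Γ ⊨ φ' ⇒' φ

  record IsNecessaryCondition (φ : Formula m) : Set where
    field
      over      : φ IsOver V'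
      necessary : Γ ⊨ α ⇒' φ

  record IsStrongestNecessaryCondition (φ : Formula m) : Set where
    field
      isNecessary : IsNecessaryCondition φ
      strongest   : ∀ φ' → IsNecessaryCondition φ' → Γ ⊨ φ ⇒' φ'

{-# OPTIONS --safe #-}
-- The complete description χ of s over O i holds in exactly those states
-- that agent i cannot distinguish from s.  If K i α holds at s then χ is a
-- sufficient condition of α, so it implies WSC; if K i ¬α holds at s then ¬χ
-- is a necessary condition of α, so SNC implies ¬χ and hence fails at s.
-- Conversely, formulas over O i do not separate indistinguishable states.
module Submission where

open import Data.Nat using (ℕ)
open import Data.Fin using (Fin)
open import Data.Fin.Subset using (Subset; _∈_; _∩_)
open import Data.Fin.Subset.Properties
  using (_∈?_; ∉⊥; x∈p∩q⁺; x∈p∩q⁻; p⊆p∪q; q⊆p∪q; ⊆-antisym;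
         x∈⁅x⁆; x∈⁅y⁆⇒x≡y; x∈p∪q⁻)
open import Data.List using (List; []; _∷_; foldr; filter; allFin)
open import Data.List.Membership.Propositional using () renaming (_∈_ to _∈ₗ_)
open import Data.List.Membership.Propositional.Properties using (∈-filter⁺; ∈-filter⁻; ∈-allFin)
open import Data.List.Relation.Unary.Any using (here; there)
open import Data.Product using (_×_; _,_; proj₁; proj₂)
open import Data.Product.Function.NonDependent.Propositional using (_×-⇔_)
open import Data.Sum.Base using ([_,_]′)
open import Data.Sum.Function.Propositional using (_⊎-⇔_)
open import Data.Unit using (tt)
open import Data.Empty using (⊥-elim)
open import Function using (_∘_; _⇔_; mk⇔; Equivalence; id)
open import Function.Construct.Identity using (⇔-id)
open import Function.Related.TypeIsomorphisms using (→-cong-⇔; ¬-cong-⇔)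
open import Relation.Binary.PropositionalEquality using (_≡_; refl; sym; subst)
open import Relation.Nullary
  using (Dec; yes; no; contradiction; ¬?; _×-dec_; _⊎-dec_; _→-dec_; decidable-stable)
open import Defs

open Equivalence using (to; from)

-- Knowledge of the agent need not be decidable, but a propositional formula at a fixed assignment
-- is. This justifies removing the double negation in front of `SNC` in the second equivalence.
satisfies? : ∀ {m} (s : Assignment m) φ → Dec (s satisfies φ)
satisfies? s (var p)  = p ∈? s
satisfies? s true'    = yes tt
satisfies? s false'   = no id
satisfies? s (¬' φ)   = ¬? (satisfies? s φ)
satisfies? s (φ ∧' ψ) = satisfies? s φ ×-dec satisfies? s ψ
satisfies? s (φ ∨' ψ) = satisfies? s φ ⊎-dec satisfies? s ψ
satisfies? s (φ ⇒' ψ) = satisfies? s φ →-dec satisfies? s ψ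
satisfies? s (φ ⇔' ψ) = (satisfies? s φ →-dec satisfies? s ψ)
                 ×-dec (satisfies? s ψ →-dec satisfies? s φ)

module _ {m n : ℕ} (F : KnowledgeStructure m n) (s : State F) where

  ⊨⌜⌝⇔satisfies : ∀ φ → ([ F , s ]⊨ ⌜ φ ⌝) ⇔ (proj₁ s satisfies φ)
  ⊨⌜⌝⇔satisfies (var p)  = ⇔-id _
  ⊨⌜⌝⇔satisfies true'    = ⇔-id _
  ⊨⌜⌝⇔satisfies false'   = ⇔-id _
  ⊨⌜⌝⇔satisfies (¬' φ)   = ¬-cong-⇔ (⊨⌜⌝⇔satisfies φ)
  ⊨⌜⌝⇔satisfies (φ ∧' ψ) = ⊨⌜⌝⇔satisfies φ ×-⇔ ⊨⌜⌝⇔satisfies ψ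
  ⊨⌜⌝⇔satisfies (φ ∨' ψ) = ⊨⌜⌝⇔satisfies φ ⊎-⇔ ⊨⌜⌝⇔satisfies ψ
  ⊨⌜⌝⇔satisfies (φ ⇒' ψ) = →-cong-⇔ (⊨⌜⌝⇔satisfies φ) (⊨⌜⌝⇔satisfies ψ)
  ⊨⌜⌝⇔satisfies (φ ⇔' ψ) =
    →-cong-⇔ (⊨⌜⌝⇔satisfies φ) (⊨⌜⌝⇔satisfies ψ) ×-⇔
    →-cong-⇔ (⊨⌜⌝⇔satisfies ψ) (⊨⌜⌝⇔satisfies φ)

module _ {m : ℕ} {P s t : Subset m} where

  -- Indistinguishability is given as an equation between intersections, while inductions on
  -- formulas use agreement variable by variable; this and its converse translate between the two.
  ∩-≡⇒∈⇔∈ : s ∩ P ≡ t ∩ P → ∀ {p} → p ∈ P → p ∈ s ⇔ p ∈ t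
  ∩-≡⇒∈⇔∈ eq {p} p∈P = mk⇔
    (λ p∈s → proj₁ (x∈p∩q⁻ t P (subst (p ∈_) eq (x∈p∩q⁺ (p∈s , p∈P)))))
    (λ p∈t → proj₁ (x∈p∩q⁻ s P (subst (p ∈_) (sym eq) (x∈p∩q⁺ (p∈t , p∈P)))))

  ∈⇔∈⇒∩-≡ : (∀ {p} → p ∈ P → p ∈ s ⇔ p ∈ t) → s ∩ P ≡ t ∩ P
  ∈⇔∈⇒∩-≡ agree = ⊆-antisym
    (λ p∈s∩P → let p∈s , p∈P = x∈p∩q⁻ s P p∈s∩P in x∈p∩q⁺ (to (agree p∈P) p∈s , p∈P))
    (λ p∈t∩P → let p∈t , p∈P = x∈p∩q⁻ t P p∈t∩P in x∈p∩q⁺ (from (agree p∈P) p∈t , p∈P))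

-- The coincidence lemma, by induction on `φ`: agreement on all of `vars φ` restricts to the
-- variables of each subformula.
satisfies-cong : ∀ {m} {s t : Assignment m} φ →
  (∀ {p} → p ∈ vars φ → p ∈ s ⇔ p ∈ t) → s satisfies φ ⇔ t satisfies φ
satisfies-cong (var p)  agree = agree (x∈⁅x⁆ p)
satisfies-cong true'    agree = ⇔-id _
satisfies-cong false'   agree = ⇔-id _
satisfies-cong (¬' φ)   agree = ¬-cong-⇔ (satisfies-cong φ agree)
satisfies-cong (φ ∧' ψ) agree =
  satisfies-cong φ (agree ∘ p⊆p∪q (vars ψ)) ×-⇔
  satisfies-cong ψ (agree ∘ q⊆p∪q (vars φ) (vars ψ))
satisfies-cong (φ ∨' ψ) agree =
  satisfies-cong φ (agree ∘ p⊆p∪q (vars ψ)) ⊎-⇔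
  satisfies-cong ψ (agree ∘ q⊆p∪q (vars φ) (vars ψ))
satisfies-cong (φ ⇒' ψ) agree =
  →-cong-⇔ (satisfies-cong φ (agree ∘ p⊆p∪q (vars ψ)))
           (satisfies-cong ψ (agree ∘ q⊆p∪q (vars φ) (vars ψ)))
satisfies-cong {s = s} {t} (φ ⇔' ψ) agree = →-cong-⇔ φ⇔ ψ⇔ ×-⇔ →-cong-⇔ ψ⇔ φ⇔
  where
  φ⇔ : s satisfies φ ⇔ t satisfies φ
  φ⇔ = satisfies-cong φ (agree ∘ p⊆p∪q (vars ψ))
  ψ⇔ : s satisfies ψ ⇔ t satisfies ψ
  ψ⇔ = satisfies-cong ψ (agree ∘ q⊆p∪q (vars φ) (vars ψ))

module _ {m : ℕ} (s : Assignment m) where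

  literal : Fin m → Formula m
  literal p with p ∈? s
  ... | yes _ = var p
  ... | no  _ = ¬' var p

  -- `vars (literal p)` is stuck on the test `p ∈? s`, although both signs give the same variable;
  -- rewriting along this equation avoids repeating the case split.
  vars-literal : ∀ p → vars (literal p) ≡ vars (var p)
  vars-literal p with p ∈? s
  ... | yes _ = refl
  ... | no  _ = refl

  -- In this form the sign of the literal disappears, so that conjunctions can be treated without
  -- further reference to it.
  satisfies-literal : ∀ t p → t satisfies literal p ⇔ (p ∈ t ⇔ p ∈ s)
  satisfies-literal t p with p ∈? s
  ... | yes p∈s = mk⇔ (λ p∈t → mk⇔ (λ _ → p∈s) (λ _ → p∈t)) (λ e → from e p∈s)
  ... | no  p∉s = mk⇔ (λ p∉t → mk⇔ (⊥-elim ∘ p∉t) (⊥-elim ∘ p∉s)) (λ e → p∉s ∘ to e)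

  conjunction : List (Fin m) → Formula m
  conjunction = foldr (λ p φ → literal p ∧' φ) true'

  vars-conjunction : ∀ ps {p} → p ∈ vars (conjunction ps) → p ∈ₗ ps
  vars-conjunction []       p∈ = contradiction p∈ ∉⊥
  vars-conjunction (q ∷ ps) p∈ =
    [ (λ p∈q → here (x∈⁅y⁆⇒x≡y q (subst (_ ∈_) (vars-literal q) p∈q)))
    , there ∘ vars-conjunction ps
    ]′ (x∈p∪q⁻ _ _ p∈)

  satisfies-conjunction : ∀ t ps →
    t satisfies conjunction ps ⇔ (∀ {p} → p ∈ₗ ps → p ∈ t ⇔ p ∈ s)
  satisfies-conjunction t []       = mk⇔ (λ _ ()) (λ _ → tt)
  satisfies-conjunction t (q ∷ ps) = mk⇔
    (λ { (lit , _) (here refl) → to (satisfies-literal t q) lit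
       ; (_ , con) (there p∈)  → to (satisfies-conjunction t ps) con p∈ })
    (λ agree → from (satisfies-literal t q) (agree (here refl))
             , from (satisfies-conjunction t ps) (λ p∈ → agree (there p∈)))

  module _ (P : Subset m) where

    -- The minterm of `s` on `P`. Finiteness of the set of variables is what makes it a formula.
    description : Formula m
    description = conjunction (filter (_∈? P) (allFin m))

    description-IsOver : description IsOver P
    description-IsOver = proj₂ ∘ ∈-filter⁻ (_∈? P) {xs = allFin m} ∘ vars-conjunction _

    satisfies-description : ∀ t → t satisfies description ⇔ (t ∩ P ≡ s ∩ P)
    satisfies-description t = mk⇔
      (λ sat → ∈⇔∈⇒∩-≡ λ {p} p∈P →
        to (satisfies-conjunction t _) sat (∈-filter⁺ (_∈? P) (∈-allFin p) p∈P))
      (λ eq → from (satisfies-conjunction t _)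
        (∩-≡⇒∈⇔∈ eq ∘ proj₂ ∘ ∈-filter⁻ (_∈? P) {xs = allFin m}))

theorem13 : ∀ {m n : ℕ} (F : KnowledgeStructure m n) (α : Formula m) (i : Fin n)
    (WSC SNC : Formula m) →
    IsWeakestSufficientCondition (Γ F) α (O F i) WSC →
    IsStrongestNecessaryCondition (Γ F) α (O F i) SNC →
    (s : State F) →
    ([ F , s ]⊨ (K i ⌜ α ⌝ ⇔' ⌜ WSC ⌝)) ×
    ([ F , s ]⊨ ((¬' K i (¬' ⌜ α ⌝)) ⇔' ⌜ SNC ⌝))
theorem13 {m} F α i WSC SNC wsc snc s@(a , _) =
  (Kα⇒WSC , WSC⇒Kα) , (¬K¬α⇒SNC , SNC⇒¬K¬α)
  where
  open IsWeakestSufficientCondition wsc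
  open IsSufficientCondition isSufficient renaming (over to WSC-over)
  open IsStrongestNecessaryCondition snc
  open IsNecessaryCondition isNecessary renaming (over to SNC-over)

  P : Subset m
  P = O F i

  χ : Formula m
  χ = description a P

  a⊨χ : a satisfies χ
  a⊨χ = from (satisfies-description a P a) refl

  -- Used in both directions: `WSC` is carried from `a` to `t`, and `SNC` from `t` back to `a`.
  transfer : ∀ φ {t} → φ IsOver P → t ∩ P ≡ a ∩ P → t satisfies φ ⇔ a satisfies φ
  transfer φ over eq = satisfies-cong φ (∩-≡⇒∈⇔∈ eq ∘ over)

  Kα⇒WSC : [ F , s ]⊨ K i ⌜ α ⌝ → [ F , s ]⊨ ⌜ WSC ⌝
  Kα⇒WSC k = from (⊨⌜⌝⇔satisfies F s WSC) (weakest χ χ-sufficient a (proj₂ s) a⊨χ)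
    where
    χ-sufficient : IsSufficientCondition (Γ F) α P χ
    χ-sufficient = record
      { over       = description-IsOver a P
      -- A model of `Γ F` satisfying `χ` is a state the agent cannot tell from `s`, so the knowledge
      -- `k` applies there.
      ; sufficient = λ t t⊨Γ t⊨χ → to (⊨⌜⌝⇔satisfies F (t , t⊨Γ) α)
                       (k (t , t⊨Γ) (to (satisfies-description a P t) t⊨χ))
      }

  WSC⇒Kα : [ F , s ]⊨ ⌜ WSC ⌝ → [ F , s ]⊨ K i ⌜ α ⌝
  WSC⇒Kα w s'@(t , t⊨Γ) eq = from (⊨⌜⌝⇔satisfies F s' α)
    (sufficient t t⊨Γ (from (transfer WSC WSC-over eq) (to (⊨⌜⌝⇔satisfies F s WSC) w)))

  ¬K¬α⇒SNC : [ F , s ]⊨ (¬' K i (¬' ⌜ α ⌝)) → [ F , s ]⊨ ⌜ SNC ⌝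
  -- The hypothesis `¬k` supplies no explicit state where `α` holds, so the argument is by
  -- contradiction: if `SNC` failed at `a`, then `α` would fail at every state indistinguishable
  -- from `s`.
  ¬K¬α⇒SNC ¬k = from (⊨⌜⌝⇔satisfies F s SNC) (decidable-stable (satisfies? a SNC)
    λ a⊭SNC → ¬k λ s'@(t , t⊨Γ) eq s'⊨α → a⊭SNC (to (transfer SNC SNC-over eq)
      (necessary t t⊨Γ (to (⊨⌜⌝⇔satisfies F s' α) s'⊨α))))

  SNC⇒¬K¬α : [ F , s ]⊨ ⌜ SNC ⌝ → [ F , s ]⊨ (¬' K i (¬' ⌜ α ⌝))
  SNC⇒¬K¬α c k =
    strongest (¬' χ) ¬χ-necessary a (proj₂ s) (to (⊨⌜⌝⇔satisfies F s SNC) c) a⊨χ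
    where
    ¬χ-necessary : IsNecessaryCondition (Γ F) α P (¬' χ)
    ¬χ-necessary = record
      -- Negation leaves `vars` unchanged, so the proof for `χ` also serves for its negation.
      { over      = description-IsOver a P
      ; necessary = λ t t⊨Γ t⊨α t⊨χ → k (t , t⊨Γ) (to (satisfies-description a P t) t⊨χ)
                      (from (⊨⌜⌝⇔satisfies F (t , t⊨Γ) α) t⊨α)
      }
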